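{- For every integer $n\ge 1$, let $\overline{P}(n)_2$ be the $n\times n$ integer matrix with entries $\overline{p}_{i,j}\in\{0,1\}$, $0\le i,j<n$, defined by $\overline{p}_{i,j}\equiv\binom{i+j}{i}\pmod 2$. Then the determinant over $\mathbf{Z}$ satisfies $$\det(\overline{P}(n)_2)=\prod_{k=0}^{n-1}(-1)^{s_k},$$ where $s_k$ is the Thue–Morse sequence.
   Context: The Thue–Morse sequence is defined by $s_k=\sum_i\nu_i \pmod 2\in\{0,1\}$ where $k=\sum_i \nu_i 2^i$ is the binary expansion of $k$; equivalently $s_0=0$, $s_{2k}=s_k$, $s_{2k+1}=1-s_k$. -}

module Defs where

open import Data.Digit using (toDigits)
open import Data.Fin.Base using (Fin; toℕ; zero)
open import Data.Integer.Base using (ℤ; +_; -1ℤ; 1ℤ; _*_; _^_)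
open import Data.Integer.Properties using (+-0-commutativeMonoid; *-1-commutativeMonoid)
open import Data.List.Base using (map)
open import Data.Nat.Base as ℕ using (ℕ; zero; suc; _%_)
open import Data.Nat.Combinatorics using (_C_)
open import Data.Nat.ListAction using () renaming (sum to sumℕ)
open import Data.Product.Base using (proj₁)
open import Data.Vec.Functional using (Vector; removeAt; tail)
open import Algebra.Properties.CommutativeMonoid.Sum +-0-commutativeMonoid public using (sum)
open import Algebra.Properties.CommutativeMonoid.Sum *-1-commutativeMonoid public using () renaming (sum to product)

Matrix : ℕ → ℕ → Set
Matrix m n = Vector (Vector ℤ n) m

-- Laplace expansion along the first row; the empty matrix has determinant 1.
det : ∀ {n} → Matrix n n → ℤ
det {zero}  A = 1ℤ
det {suc n} A = sum λ j →
  -1ℤ ^ toℕ j * A zero j * det (λ i → removeAt (tail A i) j)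

thueMorse : ℕ → ℕ
thueMorse k = sumℕ (map toℕ (proj₁ (toDigits 2 k))) % 2

pascalMod2 : (n : ℕ) → Matrix n n
pascalMod2 n i j = + (((toℕ i ℕ.+ toℕ j) C toℕ i) % 2)

-- Modulo 2, C(i+j, i) is 1 exactly when i and j have disjoint binary digits.
-- The 2 × 2 case factors as
--   [1 1; 1 0] = [1 0; 1 1] · diag(1, -1) · [1 1; 0 1],
-- and the 2ᵏ × 2ᵏ matrices are its tensor powers, so they factor as L D Lᵀ with
-- L i l = C(i, l) mod 2 unitriangular and D the diagonal matrix of the signs
-- (-1)^(s_l).  Since L is lower triangular, the factorization restricts to every
-- leading principal submatrix, and the determinant is that of D.

module Submission where

open import Defs
open import Data.Digit using (Bit; Expansion; fromDigits; toDigits)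
open import Data.Fin.Base as Fin using (Fin; zero; suc; toℕ; punchIn; lift)
open import Data.Fin.Properties using (toℕ-injective; toℕ<n)
open import Data.Integer.Base as ℤ using (ℤ; 0ℤ; -1ℤ; 1ℤ; _+_; _*_; _^_; -_)
open import Data.Integer.Properties
  using (+-*-semiring; +-comm; +-assoc; +-identityʳ; *-identityˡ; *-zeroʳ)
open import Data.Integer.Tactic.RingSolver using (solve-∀)
open import Data.List.Base using ([]; _∷_; map)
open import Data.Nat.Base as ℕ using (ℕ; zero; suc; _≥_; z<s; s<s; _%_; ⌈_/2⌉)
open import Data.Nat.Combinatorics using (_C_; nCk+nC[k+1]≡[n+1]C[k+1]; k>n⇒nCk≡0; nCn≡1)
open import Data.Nat.DivMod
  using (_divMod_; result; %-distribˡ-+; m*n%n≡0; m%n%n≡m%n; m<n⇒m%n≡m; [m+kn]%n≡m%n)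
open import Data.Nat.Induction using (Acc; acc; <-wellFounded)
open import Data.Nat.ListAction using () renaming (sum to sumℕ)
import Data.Nat.Properties as ℕ
open import Data.Product.Base using (_×_; _,_)
open import Data.Vec.Functional using (Vector; removeAt) renaming (_∷_ to _∷ᵛ_)
open import Function.Base using (_∘_)
open import Algebra.Properties.Semiring.Sum +-*-semiring
  using (sum-cong-≗; sum-replicate-zero; ∑-distrib-+; *-distribˡ-sum)
open import Relation.Binary.PropositionalEquality
  using (_≡_; _≗_; refl; sym; trans; cong; cong₂; module ≡-Reasoning)
open ≡-Reasoning

-- Determinants with a sparse first row or column

sgn : ∀ {n} → Fin n → ℤ
sgn j = -1ℤ ^ toℕ j

sum-zero : ∀ {n} {f : Vector ℤ n} → (∀ i → f i ≡ 0ℤ) → sum f ≡ 0ℤ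
sum-zero {n} f≗0 = trans (sum-cong-≗ f≗0) (sum-replicate-zero n)

det-cong : ∀ {n} (A B : Matrix n n) → (∀ i j → A i j ≡ B i j) → det A ≡ det B
det-cong {zero}  A B A≗B = refl
det-cong {suc n} A B A≗B = sum-cong-≗ λ j →
  cong₂ (λ a d → sgn j * a * d) (A≗B zero j)
    (det-cong (λ i → removeAt (A (suc i)) j) (λ i → removeAt (B (suc i)) j)
      λ i k → A≗B (suc i) (punchIn j k))

det-first-row : ∀ {n} (A : Matrix (suc n) (suc n)) → (∀ j → A zero (suc j) ≡ 0ℤ) →
  det A ≡ A zero zero * det (λ i j → A (suc i) (suc j))
det-first-row A row = begin
  1ℤ * A zero zero * d + sum rest  ≡⟨ cong (1ℤ * A zero zero * d +_) (sum-zero rest≗0) ⟩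
  1ℤ * A zero zero * d + 0ℤ        ≡⟨ +-identityʳ _ ⟩
  1ℤ * A zero zero * d             ≡⟨ cong (_* d) (*-identityˡ (A zero zero)) ⟩
  A zero zero * d                  ∎
  where
  d = det (λ i j → A (suc i) (suc j))
  m = λ j → det (λ i → removeAt (A (suc i)) (suc j))
  rest = λ j → sgn (suc j) * A zero (suc j) * m j
  rest≗0 : ∀ j → rest j ≡ 0ℤ
  rest≗0 j = begin
    sgn (suc j) * A zero (suc j) * m j  ≡⟨ cong (λ a → sgn (suc j) * a * m j) (row j) ⟩
    sgn (suc j) * 0ℤ * m j              ≡⟨ cong (_* m j) (*-zeroʳ (sgn (suc j))) ⟩
    0ℤ                                  ∎

-- By induction on the size: the summand at column zero has a zero coefficient, and every other
-- minor still has a zero first column.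
det-zero-column : ∀ {n} (A : Matrix (suc n) (suc n)) → (∀ i → A i zero ≡ 0ℤ) → det A ≡ 0ℤ
det-zero-column A col = sum-zero (vanishes A col)
  where
  vanishes : ∀ {n} (A : Matrix (suc n) (suc n)) → (∀ i → A i zero ≡ 0ℤ) → ∀ j →
    sgn j * A zero j * det (λ i → removeAt (A (suc i)) j) ≡ 0ℤ
  vanishes A col zero = cong (λ a → 1ℤ * a * det (λ i → removeAt (A (suc i)) zero)) (col zero)
  vanishes {suc n} A col j@(suc _) =
    trans (cong (sgn j * A zero j *_) (det-zero-column (λ i → removeAt (A (suc i)) j) (col ∘ suc)))
          (*-zeroʳ (sgn j * A zero j))

-- Determinants under a rank-one update

-- Removing the indices a and b in either order leaves the same remaining indices,
-- but the two orders carry opposite signs, so symmetric coefficients cancel.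
alternating-sum-vanishes : ∀ {n} (F : Fin (2 ℕ.+ n) → Fin (2 ℕ.+ n) → ℤ) →
  (∀ a b → F a b ≡ F b a) →
  (G : (Fin n → Fin (2 ℕ.+ n)) → ℤ) → (∀ {e e′} → e ≗ e′ → G e ≡ G e′) →
  sum (λ j → sum λ k →
    sgn j * sgn k * (F j (punchIn j k) * G (λ l → punchIn j (punchIn k l)))) ≡ 0ℤ
alternating-sum-vanishes {n} F F-sym G G-cong = begin
  sum (W zero) + sum (λ j → W (suc j) zero + sum (W (suc j) ∘ suc))
    ≡⟨ cong (sum (W zero) +_) (∑-distrib-+ (λ j → W (suc j) zero) (λ j → sum (W (suc j) ∘ suc))) ⟩
  sum (W zero) + (sum (λ j → W (suc j) zero) + sum (λ j → sum (W (suc j) ∘ suc)))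
    ≡⟨ cong (λ z → sum (W zero) + (sum (λ j → W (suc j) zero) + z)) (inner F F-sym G G-cong) ⟩
  sum (W zero) + (sum (λ j → W (suc j) zero) + 0ℤ)
    ≡⟨ cong (sum (W zero) +_) (+-identityʳ _) ⟩
  sum (W zero) + sum (λ j → W (suc j) zero)
    ≡⟨ ∑-distrib-+ (W zero) (λ j → W (suc j) zero) ⟨
  sum (λ j → W zero j + W (suc j) zero)
    ≡⟨ sum-zero cancel ⟩
  0ℤ ∎
  where
  W : Fin (2 ℕ.+ n) → Fin (suc n) → ℤ
  W j k = sgn j * sgn k * (F j (punchIn j k) * G (λ l → punchIn j (punchIn k l)))

  opposite : ∀ s f g → 1ℤ * s * (f * g) + -1ℤ * s * 1ℤ * (f * g) ≡ 0ℤ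
  opposite = solve-∀

  -- The ordered pairs (0, j+1) and (j+1, 0) both leave the indices `suc (punchIn j l)`, with signs
  -- `sgn j` and `-1ℤ * sgn j`.
  cancel : ∀ j → W zero j + W (suc j) zero ≡ 0ℤ
  cancel j = begin
    W zero j + W (suc j) zero
      ≡⟨ cong (λ f → W zero j + sgn (suc j) * 1ℤ * (f * g)) (F-sym (suc j) zero) ⟩
    W zero j + sgn (suc j) * 1ℤ * (F zero (suc j) * g)
      ≡⟨ opposite (sgn j) (F zero (suc j)) g ⟩
    0ℤ ∎
    where g = G (λ l → suc (punchIn j l))

  signs : ∀ s t x → -1ℤ * s * (-1ℤ * t) * x ≡ s * t * x
  signs = solve-∀

  -- Pairs avoiding index 0: the two extra signs cancel, and 0 stays among the remaining indices as
  -- their first element, so composing `G` with `lift 1` reduces to the smaller statement. `G-cong`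
  -- stands in for function extensionality, since the index maps agree only pointwise.
  inner : ∀ {n} (F : Fin (2 ℕ.+ n) → Fin (2 ℕ.+ n) → ℤ) →
    (∀ a b → F a b ≡ F b a) →
    (G : (Fin n → Fin (2 ℕ.+ n)) → ℤ) → (∀ {e e′} → e ≗ e′ → G e ≡ G e′) →
    sum (λ (j : Fin (suc n)) → sum λ (k : Fin n) →
      sgn (suc j) * sgn (suc k) *
        (F (suc j) (suc (punchIn j k)) * G (λ l → punchIn (suc j) (punchIn (suc k) l)))) ≡ 0ℤ
  inner {zero}  F F-sym G G-cong = refl
  inner {suc n} F F-sym G G-cong = begin
    sum (λ j → sum λ k → sgn (suc j) * sgn (suc k) * (F′ j (punchIn j k) * G (e j k)))
      ≡⟨ sum-cong-≗ (λ j → sum-cong-≗ λ k → signs (sgn j) (sgn k) (F′ j (punchIn j k) * G (e j k))) ⟩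
    sum (λ j → sum λ k → sgn j * sgn k * (F′ j (punchIn j k) * G (e j k)))
      ≡⟨ sum-cong-≗ (λ j → sum-cong-≗ λ k → cong (λ g → sgn j * sgn k * (F′ j (punchIn j k) * g)) (lift-e j k)) ⟩
    sum (λ j → sum λ k → sgn j * sgn k * (F′ j (punchIn j k) * G (lift 1 (e′ j k))))
      ≡⟨ alternating-sum-vanishes F′ (λ a b → F-sym (suc a) (suc b)) (G ∘ lift 1)
           (λ e≗ → G-cong λ { zero → refl ; (suc l) → cong suc (e≗ l) }) ⟩
    0ℤ ∎
    where
    F′ : Fin (2 ℕ.+ n) → Fin (2 ℕ.+ n) → ℤ
    F′ a b = F (suc a) (suc b)

    e : Fin (2 ℕ.+ n) → Fin (suc n) → Fin (suc n) → Fin (3 ℕ.+ n)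
    e j k l = punchIn (suc j) (punchIn (suc k) l)

    e′ : Fin (2 ℕ.+ n) → Fin (suc n) → Fin n → Fin (2 ℕ.+ n)
    e′ j k l = punchIn j (punchIn k l)

    lift-e : ∀ j k → G (e j k) ≡ G (lift 1 (e′ j k))
    lift-e j k = G-cong λ { zero → refl ; (suc l) → refl }

-- Column `k` of `B` sits at position `suc k`, which flips its sign, and the minor there keeps the
-- tail of `x` as its first column.
det-∷ᵛ : ∀ {n} (x : Vector ℤ (2 ℕ.+ n)) (B : Matrix (2 ℕ.+ n) (suc n)) →
  det (λ i → x i ∷ᵛ B i) ≡
  x zero * det (λ i → B (suc i)) +
  sum (λ k → - sgn k * B zero k * det (λ i → x (suc i) ∷ᵛ removeAt (B (suc i)) k))
det-∷ᵛ x B = cong₂ _+_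
  (cong (_* det (λ i → B (suc i))) (*-identityˡ (x zero)))
  (sum-cong-≗ λ k → trans
    (cong (sgn (suc k) * B zero k *_) (minor k))
    (neg (sgn k) (B zero k) (det (λ i → x (suc i) ∷ᵛ removeAt (B (suc i)) k))))
  where
  minor : ∀ k → det (λ i → removeAt (x (suc i) ∷ᵛ B (suc i)) (suc k)) ≡
                det (λ i → x (suc i) ∷ᵛ removeAt (B (suc i)) k)
  minor k = det-cong (λ i → removeAt (x (suc i) ∷ᵛ B (suc i)) (suc k))
                     (λ i → x (suc i) ∷ᵛ removeAt (B (suc i)) k)
                     λ { i zero → refl ; i (suc l) → refl }

  neg : ∀ s b d → -1ℤ * s * b * d ≡ - s * b * d
  neg = solve-∀

-- Multilinearity in the columns: choosing the update in two columns gives proportional columns, so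
-- only terms with at most one updated column survive. Summand `j` replaces column `j` of `C` by `x`
-- and moves it to the front, at the cost of `sgn j`. The proof expands along the first row and
-- applies induction to the minors.
det-rank-one-update : ∀ {n} (C : Matrix (suc n) (suc n)) (x u : Vector ℤ (suc n)) →
  det (λ i j → C i j + x i * u j) ≡
  det C + sum (λ j → sgn j * u j * det (λ i → x i ∷ᵛ removeAt (C i) j))
det-rank-one-update {zero} C x u = base (C zero zero) (x zero) (u zero)
  where
  base : ∀ c x u → 1ℤ * (c + x * u) * 1ℤ + 0ℤ ≡
    1ℤ * c * 1ℤ + 0ℤ + (1ℤ * u * (1ℤ * x * 1ℤ + 0ℤ) + 0ℤ)
  base = solve-∀
det-rank-one-update {suc n} C x u = begin
  sum (λ j → sgn j * (c j + x₀ * u j) * det (λ i k → C (suc i) (punchIn j k) + x (suc i) * u (punchIn j k)))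
    ≡⟨ sum-cong-≗ (λ j → cong (sgn j * (c j + x₀ * u j) *_)
         (det-rank-one-update (λ i → removeAt (C (suc i)) j) (x ∘ suc) (removeAt u j))) ⟩
  sum (λ j → sgn j * (c j + x₀ * u j) * (d j + sum (λ k → sgn k * u (punchIn j k) * M j k)))
    ≡⟨ sum-cong-≗ regroup ⟩
  sum (λ j → sgn j * c j * d j + sgn j * u j * b j + sum (V j))
    ≡⟨ ∑-distrib-+ (λ j → sgn j * c j * d j + sgn j * u j * b j) (λ j → sum (V j)) ⟩
  sum (λ j → sgn j * c j * d j + sgn j * u j * b j) + sum (λ j → sum (V j))
    ≡⟨ cong₂ _+_ (∑-distrib-+ (λ j → sgn j * c j * d j) (λ j → sgn j * u j * b j))
         (alternating-sum-vanishes F F-sym G G-cong) ⟩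
  det C + sum (λ j → sgn j * u j * b j) + 0ℤ
    ≡⟨ +-identityʳ _ ⟩
  det C + sum (λ j → sgn j * u j * b j) ∎
  where
  x₀ = x zero
  c = C zero
  b d : Fin (2 ℕ.+ n) → ℤ
  b j = det (λ i → x i ∷ᵛ removeAt (C i) j)
  d j = det (λ i → removeAt (C (suc i)) j)

  G : (Fin n → Fin (2 ℕ.+ n)) → ℤ
  G e = det (λ i → x (suc i) ∷ᵛ (C (suc i) ∘ e))

  G-cong : ∀ {e e′} → e ≗ e′ → G e ≡ G e′
  G-cong {e} {e′} e≗ = det-cong (λ i → x (suc i) ∷ᵛ (C (suc i) ∘ e)) (λ i → x (suc i) ∷ᵛ (C (suc i) ∘ e′))
    λ { i zero → refl ; i (suc l) → cong (C (suc i)) (e≗ l) }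

  M : Fin (2 ℕ.+ n) → Fin (suc n) → ℤ
  M j k = G (λ l → punchIn j (punchIn k l))

  -- Coefficient of the minor without columns `a` and `b` in the leftover double sum. Its symmetry
  -- is what makes that sum vanish.
  F : Fin (2 ℕ.+ n) → Fin (2 ℕ.+ n) → ℤ
  F a b = c a * u b + c b * u a + x₀ * u a * u b

  F-sym : ∀ a b → F a b ≡ F b a
  F-sym a b = symmetric (c a) (c b) (u a) (u b) x₀
    where
    symmetric : ∀ ca cb ua ub x → ca * ub + cb * ua + x * ua * ub ≡ cb * ua + ca * ub + x * ub * ua
    symmetric = solve-∀

  V : Fin (2 ℕ.+ n) → Fin (suc n) → ℤ
  V j k = sgn j * sgn k * (F j (punchIn j k) * M j k)

  regroup : ∀ j →
    sgn j * (c j + x₀ * u j) * (d j + sum (λ k → sgn k * u (punchIn j k) * M j k)) ≡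
    sgn j * c j * d j + sgn j * u j * b j + sum (V j)
  regroup j = begin
    sgn j * (c j + x₀ * u j) * (d j + sum P)
      -- Adding and subtracting `sgn j * u j * sum Q` completes `x₀ * d j` to the expansion of
      -- `b j`.
      ≡⟨ expand (sgn j) (c j) x₀ (u j) (d j) (sum P) (sum Q) ⟩
    sgn j * c j * d j + sgn j * u j * (x₀ * d j + sum Q) + (α * sum P + β * sum Q)
      ≡⟨ cong₂ (λ a b → sgn j * c j * d j + sgn j * u j * a + b)
           (sym (det-∷ᵛ x (λ i → removeAt (C i) j))) collect ⟩
    sgn j * c j * d j + sgn j * u j * b j + sum (V j) ∎
    where
    P Q : Fin (suc n) → ℤ
    P k = sgn k * u (punchIn j k) * M j k
    Q k = - sgn k * c (punchIn j k) * M j k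
    α = sgn j * (c j + x₀ * u j)
    β = - (sgn j * u j)

    expand : ∀ s c x u d p q → s * (c + x * u) * (d + p) ≡
      s * c * d + s * u * (x * d + q) + (s * (c + x * u) * p + - (s * u) * q)
    expand = solve-∀

    combine : ∀ s t cj ck uj uk x m →
      s * (cj + x * uj) * (t * uk * m) + - (s * uj) * (- t * ck * m) ≡
      s * t * ((cj * uk + ck * uj + x * uj * uk) * m)
    combine = solve-∀

    collect : α * sum P + β * sum Q ≡ sum (V j)
    collect = begin
      α * sum P + β * sum Q
        ≡⟨ cong₂ _+_ (*-distribˡ-sum α P) (*-distribˡ-sum β Q) ⟩
      sum (λ k → α * P k) + sum (λ k → β * Q k)
        ≡⟨ ∑-distrib-+ (λ k → α * P k) (λ k → β * Q k) ⟨
      sum (λ k → α * P k + β * Q k)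
        ≡⟨ sum-cong-≗ (λ k → combine (sgn j) (sgn k) (c j) (c (punchIn j k)) (u j) (u (punchIn j k)) x₀ (M j k)) ⟩
      sum (V j) ∎

-- Elimination and the determinant of `L D Lᵀ`

-- Replacing any column of `B` but the first by `x` leaves a zero column in the minor below
-- `x zero`, so only the replacement of the first column survives. Its first row is then `x zero`
-- followed by zeros.
det-pivot : ∀ {n} (B : Matrix (suc n) (suc n)) (x u : Vector ℤ (suc n)) →
  (∀ j → B zero j ≡ 0ℤ) → (∀ i → B i zero ≡ 0ℤ) →
  det (λ i j → B i j + x i * u j) ≡ x zero * u zero * det (λ i j → B (suc i) (suc j))
det-pivot B x u row col = begin
  det (λ i j → B i j + x i * u j)
    ≡⟨ det-rank-one-update B x u ⟩
  det B + (1ℤ * u zero * e zero + sum (λ j → sgn (suc j) * u (suc j) * e (suc j)))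
    ≡⟨ cong₂ (λ a b → a + (1ℤ * u zero * e zero + b)) (det-zero-column B col)
         (sum-zero λ j → trans (cong (sgn (suc j) * u (suc j) *_) (e-suc B x row col j))
                               (*-zeroʳ (sgn (suc j) * u (suc j)))) ⟩
  0ℤ + (1ℤ * u zero * e zero + 0ℤ)
    ≡⟨ cong (λ z → 0ℤ + (1ℤ * u zero * z + 0ℤ)) (e-minor B x row zero) ⟩
  0ℤ + (1ℤ * u zero * (x zero * m) + 0ℤ)
    ≡⟨ tidy (u zero) (x zero) m ⟩
  x zero * u zero * m ∎
  where
  e = λ j → det (λ i → x i ∷ᵛ removeAt (B i) j)
  m = det (λ i j → B (suc i) (suc j))

  tidy : ∀ u x m → 0ℤ + (1ℤ * u * (x * m) + 0ℤ) ≡ x * u * m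
  tidy = solve-∀

  e-minor : ∀ {n} (B : Matrix (suc n) (suc n)) (x : Vector ℤ (suc n)) → (∀ j → B zero j ≡ 0ℤ) → ∀ j →
    det (λ i → x i ∷ᵛ removeAt (B i) j) ≡ x zero * det (λ i → removeAt (B (suc i)) j)
  e-minor B x row j = det-first-row (λ i → x i ∷ᵛ removeAt (B i) j) (row ∘ punchIn j)

  e-suc : ∀ {n} (B : Matrix (suc n) (suc n)) (x : Vector ℤ (suc n)) →
    (∀ j → B zero j ≡ 0ℤ) → (∀ i → B i zero ≡ 0ℤ) → ∀ j →
    det (λ i → x i ∷ᵛ removeAt (B i) (suc j)) ≡ 0ℤ
  e-suc {suc n} B x row col j = begin
    det (λ i → x i ∷ᵛ removeAt (B i) (suc j))
      ≡⟨ e-minor B x row (suc j) ⟩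
    x zero * det (λ i → removeAt (B (suc i)) (suc j))
      ≡⟨ cong (x zero *_) (det-zero-column (λ i → removeAt (B (suc i)) (suc j)) (col ∘ suc)) ⟩
    x zero * 0ℤ
      ≡⟨ *-zeroʳ (x zero) ⟩
    0ℤ ∎

-- The summand `l = 0` is a rank-one matrix. The others have zero first row and column because `L`
-- is lower triangular, so `det-pivot` splits off `D zero` and leaves the same problem one size
-- smaller.
det-LDLᵀ : ∀ {n} (L : Matrix n n) (D : Vector ℤ n) →
  (∀ i → L i i ≡ 1ℤ) → (∀ {i j} → i Fin.< j → L i j ≡ 0ℤ) →
  det (λ i j → sum λ l → L i l * D l * L j l) ≡ product D
det-LDLᵀ {zero}  L D diag lower = refl
det-LDLᵀ {suc n} L D diag lower = begin
  det (λ i j → L i zero * D zero * L j zero + B i j)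
    ≡⟨ det-cong (λ i j → L i zero * D zero * L j zero + B i j)
         (λ i j → B i j + L i zero * D zero * L j zero)
         (λ i j → +-comm (L i zero * D zero * L j zero) (B i j)) ⟩
  det (λ i j → B i j + L i zero * D zero * L j zero)
    ≡⟨ det-pivot B (λ i → L i zero * D zero) (λ j → L j zero)
         (λ j → sum-zero λ l → cong (λ a → a * D (suc l) * L j (suc l)) (lower z<s))
         (λ i → sum-zero λ l → trans (cong (L i (suc l) * D (suc l) *_) (lower z<s))
                                     (*-zeroʳ (L i (suc l) * D (suc l)))) ⟩
  L zero zero * D zero * L zero zero * det (λ i j → B (suc i) (suc j))
    ≡⟨ cong₂ _*_ (trans (cong (λ a → a * D zero * a) (diag zero)) (unit (D zero)))
         (det-LDLᵀ (λ i j → L (suc i) (suc j)) (D ∘ suc) (diag ∘ suc) (λ i<j → lower (s<s i<j))) ⟩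
  product D ∎
  where
  B : Matrix (suc n) (suc n)
  B i j = sum λ l → L i (suc l) * D (suc l) * L j (suc l)

  unit : ∀ d → 1ℤ * d * 1ℤ ≡ d
  unit = solve-∀

-- Binomial coefficients modulo 2

binomialMod2 : ℕ → ℕ → ℤ
binomialMod2 n k = ℤ.+ ((n C k) % 2)

pascal-mod2 : ∀ n k {x y} → (n C k) % 2 ≡ x → (n C suc k) % 2 ≡ y →
  (suc n C suc k) % 2 ≡ (x ℕ.+ y) % 2
pascal-mod2 n k refl refl =
  trans (cong (_% 2) (sym (nCk+nC[k+1]≡[n+1]C[k+1] n k))) (%-distribˡ-+ (n C k) (n C suc k) 2)

-- Lucas's theorem for the prime 2, one binary digit at a time, by mutual induction through Pascal's
-- rule. Doubling is written `n * 2` so that `suc n * 2` unfolds to two successors.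
even-C-even : ∀ n k → ((n ℕ.* 2) C (k ℕ.* 2)) % 2 ≡ (n C k) % 2
even-C-odd  : ∀ n k → ((n ℕ.* 2) C suc (k ℕ.* 2)) % 2 ≡ 0
odd-C-even  : ∀ n k → (suc (n ℕ.* 2) C (k ℕ.* 2)) % 2 ≡ (n C k) % 2
odd-C-odd   : ∀ n k → (suc (n ℕ.* 2) C suc (k ℕ.* 2)) % 2 ≡ (n C k) % 2

even-C-even zero    zero    = refl
even-C-even zero    (suc k) = refl
even-C-even (suc n) zero    = refl
even-C-even (suc n) (suc k) =
  trans (pascal-mod2 (suc (n ℕ.* 2)) (suc (k ℕ.* 2)) (odd-C-odd n k) (odd-C-even n (suc k)))
        (sym (pascal-mod2 n k refl refl))
even-C-odd zero    k = refl
-- Both summands of Pascal's rule are congruent to `n C k`, so their sum is even.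
even-C-odd (suc n) k =
  trans (pascal-mod2 (suc (n ℕ.* 2)) (k ℕ.* 2) (odd-C-even n k) (odd-C-odd n k))
        (m+m%2≡0 ((n C k) % 2))
  where
  m+m%2≡0 : ∀ m → (m ℕ.+ m) % 2 ≡ 0
  m+m%2≡0 m = trans (cong (λ z → (m ℕ.+ z) % 2) (sym (ℕ.+-identityʳ m)))
             (trans (cong (_% 2) (ℕ.*-comm 2 m)) (m*n%n≡0 m 2))
odd-C-even n zero    = refl
odd-C-even n (suc k) =
  trans (pascal-mod2 (n ℕ.* 2) (suc (k ℕ.* 2)) (even-C-odd n k) (even-C-even n (suc k)))
        (m%n%n≡m%n (n C suc k) 2)
odd-C-odd n k =
  trans (pascal-mod2 (n ℕ.* 2) (k ℕ.* 2) (even-C-even n k) (even-C-odd n k))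
 (trans (cong (_% 2) (ℕ.+-identityʳ ((n C k) % 2))) (m%n%n≡m%n (n C k) 2))

pascalEntry : ℕ → ℕ → ℤ
pascalEntry i j = binomialMod2 (i ℕ.+ j) i

-- Together with the next three lemmas this is the tensor recursion: splitting off the last digits
-- of `i` and `j` multiplies the entry by the corresponding entry of [1 1; 1 0].
pascalEntry-even-even : ∀ i j → pascalEntry (i ℕ.* 2) (j ℕ.* 2) ≡ pascalEntry i j
pascalEntry-even-even i j rewrite sym (ℕ.*-distribʳ-+ 2 i j) = cong ℤ.+_ (even-C-even (i ℕ.+ j) i)

pascalEntry-even-odd : ∀ i j → pascalEntry (i ℕ.* 2) (suc (j ℕ.* 2)) ≡ pascalEntry i j
pascalEntry-even-odd i j rewrite ℕ.+-suc (i ℕ.* 2) (j ℕ.* 2) | sym (ℕ.*-distribʳ-+ 2 i j) =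
  cong ℤ.+_ (odd-C-even (i ℕ.+ j) i)

pascalEntry-odd-even : ∀ i j → pascalEntry (suc (i ℕ.* 2)) (j ℕ.* 2) ≡ pascalEntry i j
pascalEntry-odd-even i j rewrite sym (ℕ.*-distribʳ-+ 2 i j) = cong ℤ.+_ (odd-C-odd (i ℕ.+ j) i)

-- Adding two final digits 1 produces a carry: the upper index becomes even while the lower one is
-- odd.
pascalEntry-odd-odd : ∀ i j → pascalEntry (suc (i ℕ.* 2)) (suc (j ℕ.* 2)) ≡ 0ℤ
pascalEntry-odd-odd i j rewrite ℕ.+-suc (i ℕ.* 2) (j ℕ.* 2) | sym (ℕ.*-distribʳ-+ 2 i j) =
  cong ℤ.+_ (even-C-odd (suc (i ℕ.+ j)) i)

-- Binary digit sums and Thue-Morse signs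

digitSum : Expansion 2 → ℕ
digitSum ds = sumℕ (map toℕ ds)

bit-unique : ∀ (d e : Bit) m n → toℕ d ℕ.+ m ℕ.* 2 ≡ toℕ e ℕ.+ n ℕ.* 2 → d ≡ e × m ≡ n
bit-unique d e m n eq = d≡e ,
  ℕ.*-cancelʳ-≡ m n 2 (ℕ.+-cancelˡ-≡ (toℕ d) _ _
    (trans eq (cong (λ f → toℕ f ℕ.+ n ℕ.* 2) (sym d≡e))))
  where
  remainder≡ : toℕ d % 2 ≡ toℕ e % 2
  remainder≡ = trans (sym ([m+kn]%n≡m%n (toℕ d) m 2)) (trans (cong (_% 2) eq) ([m+kn]%n≡m%n (toℕ e) n 2))
  d≡e : d ≡ e
  d≡e = toℕ-injective (trans (sym (m<n⇒m%n≡m (toℕ<n d))) (trans remainder≡ (m<n⇒m%n≡m (toℕ<n e))))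

-- Expansions of one number may differ by padding zeros, which do not change the sum. This frees
-- `thueMorse` from the particular expansion that `toDigits` returns.
digitSum-unique : ∀ ds es → fromDigits ds ≡ fromDigits es → digitSum ds ≡ digitSum es
digitSum-unique []       []       eq = refl
-- The empty expansion is read as a digit zero followed by the value 0.
digitSum-unique []       (e ∷ es) eq with refl , eq′ ← bit-unique zero e 0 (fromDigits es) eq =
  digitSum-unique [] es eq′
digitSum-unique (d ∷ ds) []       eq with refl , eq′ ← bit-unique d zero (fromDigits ds) 0 eq =
  digitSum-unique ds [] eq′
digitSum-unique (d ∷ ds) (e ∷ es) eq with refl , eq′ ← bit-unique d e (fromDigits ds) (fromDigits es) eq =
  cong (toℕ d ℕ.+_) (digitSum-unique ds es eq′)

-1^[m%2]≡-1^m : ∀ m → -1ℤ ^ (m % 2) ≡ -1ℤ ^ m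
-1^[m%2]≡-1^m zero          = refl
-1^[m%2]≡-1^m (suc zero)    = refl
-1^[m%2]≡-1^m (suc (suc m)) = trans (-1^[m%2]≡-1^m m) (involutive (-1ℤ ^ m))
  where
  involutive : ∀ x → x ≡ -1ℤ * (-1ℤ * x)
  involutive = solve-∀

θ : ℕ → ℤ
θ l = -1ℤ ^ thueMorse l

θ-fromDigits : ∀ ds {l} → fromDigits ds ≡ l → θ l ≡ -1ℤ ^ digitSum ds
θ-fromDigits ds {l} eq =
  let es , eq′ = toDigits 2 l in
  trans (-1^[m%2]≡-1^m (digitSum es)) (cong (-1ℤ ^_) (digitSum-unique es ds (trans eq′ (sym eq))))

θ-even : ∀ l → θ (l ℕ.* 2) ≡ θ l
θ-even l =
  let ds , eq = toDigits 2 l in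
  trans (θ-fromDigits (zero ∷ ds) (cong (ℕ._* 2) eq)) (sym (θ-fromDigits ds eq))

θ-odd : ∀ l → θ (suc (l ℕ.* 2)) ≡ -1ℤ * θ l
θ-odd l =
  let ds , eq = toDigits 2 l in
  trans (θ-fromDigits (suc zero ∷ ds) (cong (λ m → suc (m ℕ.* 2)) eq))
        (cong (-1ℤ *_) (sym (θ-fromDigits ds eq)))

-- The factorization of the Pascal matrix modulo 2

-- For odd `n` the last pair reaches one index too far, namely `n`. The hypothesis on `f n` makes
-- that extra value harmless.
sum-pairs : ∀ n (f : ℕ → ℤ) → f n ≡ 0ℤ →
  sum {n} (f ∘ toℕ) ≡ sum {⌈ n /2⌉} (λ m → f (toℕ m ℕ.* 2) + f (suc (toℕ m ℕ.* 2)))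
sum-pairs zero          f fn≡0 = refl
sum-pairs (suc zero)    f f1≡0 =
  cong (_+ 0ℤ) (trans (sym (+-identityʳ (f 0))) (cong (f 0 +_) (sym f1≡0)))
sum-pairs (suc (suc n)) f fn≡0 =
  trans (cong (λ s → f 0 + (f 1 + s)) (sum-pairs n (λ l → f (2 ℕ.+ l)) fn≡0))
        (sym (+-assoc (f 0) (f 1)
          (sum {⌈ n /2⌉} λ m → f (2 ℕ.+ toℕ m ℕ.* 2) + f (3 ℕ.+ toℕ m ℕ.* 2))))

m*2<n⇒m<⌈n/2⌉ : ∀ m n → m ℕ.* 2 ℕ.< n → m ℕ.< ⌈ n /2⌉
m*2<n⇒m<⌈n/2⌉ zero    (suc zero)    _                   = z<s
m*2<n⇒m<⌈n/2⌉ zero    (suc (suc n)) _                   = z<s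
m*2<n⇒m<⌈n/2⌉ (suc m) (suc (suc n)) (s<s (s<s m*2<n)) = s<s (m*2<n⇒m<⌈n/2⌉ m n m*2<n)

term termPair : ℕ → ℕ → ℕ → ℤ
term i j l = binomialMod2 i l * θ l * binomialMod2 j l
termPair i j m = term i j (m ℕ.* 2) + term i j (suc (m ℕ.* 2))

term-vanishes : ∀ {i} j {l} → i ℕ.< l → term i j l ≡ 0ℤ
term-vanishes j {l} i<l =
  cong (λ c → ℤ.+ (c % 2) * θ l * binomialMod2 j l) (k>n⇒nCk≡0 i<l)

-- The 2 × 2 factorization inside the tensor product: `a`, `b`, `c`, `d` are the residues supplied
-- by Lucas's theorem, and the signs 1 and -1 come from the last digit of `l`.
termPair-≡ : ∀ {i j} m {a b c d} →
  (i C (m ℕ.* 2)) % 2 ≡ a → (i C suc (m ℕ.* 2)) % 2 ≡ b →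
  (j C (m ℕ.* 2)) % 2 ≡ c → (j C suc (m ℕ.* 2)) % 2 ≡ d →
  termPair i j m ≡ ℤ.+ a * θ m * ℤ.+ c + ℤ.+ b * (-1ℤ * θ m) * ℤ.+ d
termPair-≡ {i} {j} m refl refl refl refl =
  cong₂ (λ s t → binomialMod2 i (m ℕ.* 2) * s * binomialMod2 j (m ℕ.* 2) +
                 binomialMod2 i (suc (m ℕ.* 2)) * t * binomialMod2 j (suc (m ℕ.* 2)))
        (θ-even m) (θ-odd m)

-- Strong induction from `n` to `⌈ n /2⌉`, pairing the summands at `2m` and `2m+1`. Proving it for
-- arbitrary `n` yields every leading principal submatrix directly.
pascalEntry-LDLᵀ : ∀ n i j → i ℕ.< n → sum {n} (term i j ∘ toℕ) ≡ pascalEntry i j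
pascalEntry-LDLᵀ n = go n (<-wellFounded n)
  where
  go : ∀ n → Acc ℕ._<_ n → ∀ i j → i ℕ.< n → sum {n} (term i j ∘ toℕ) ≡ pascalEntry i j
  -- Size 1 is a base case because `⌈ 1 /2⌉` is again 1.
  go (suc zero)        _        zero j _ = refl
  go (suc zero)        _        (suc i) j (s<s ())
  go n@(suc (suc n-2)) (acc rs) i j i<n =
    trans (sum-pairs n (term i j) (term-vanishes j i<n)) (pairs i j i<n)
    where
    halve : ∀ i j → i ℕ.* 2 ℕ.< n → sum {⌈ n /2⌉} (term i j ∘ toℕ) ≡ pascalEntry i j
    halve i j i*2<n = go ⌈ n /2⌉ (rs (ℕ.⌈n/2⌉<n n-2)) i j (m*2<n⇒m<⌈n/2⌉ i n i*2<n)

    reduce : ∀ {i′ j′} i j → i ℕ.* 2 ℕ.< n →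
      (∀ m → termPair i′ j′ m ≡ term i j m) →
      pascalEntry i′ j′ ≡ pascalEntry i j →
      sum {⌈ n /2⌉} (termPair i′ j′ ∘ toℕ) ≡ pascalEntry i′ j′
    reduce i j i*2<n term≡ pascal≡ =
      trans (sum-cong-≗ {⌈ n /2⌉} (term≡ ∘ toℕ)) (trans (halve i j i*2<n) (sym pascal≡))

    pairs : ∀ i j → i ℕ.< n → sum {⌈ n /2⌉} (termPair i j ∘ toℕ) ≡ pascalEntry i j
    pairs i j i<n with i divMod 2 | j divMod 2
    ... | result i′ zero refl | result j′ zero refl =
      reduce i′ j′ i<n
        (λ m → trans (termPair-≡ m (even-C-even i′ m) (even-C-odd i′ m) (even-C-even j′ m) (even-C-odd j′ m))
                     (+-identityʳ (term i′ j′ m)))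
        (pascalEntry-even-even i′ j′)
    ... | result i′ zero refl | result j′ (suc zero) refl =
      reduce i′ j′ i<n
        (λ m → trans (termPair-≡ m (even-C-even i′ m) (even-C-odd i′ m) (odd-C-even j′ m) (odd-C-odd j′ m))
                     (+-identityʳ (term i′ j′ m)))
        (pascalEntry-even-odd i′ j′)
    ... | result i′ (suc zero) refl | result j′ zero refl =
      reduce i′ j′ (ℕ.<⇒≤ i<n)
        (λ m → trans (termPair-≡ m (odd-C-even i′ m) (odd-C-odd i′ m) (even-C-even j′ m) (even-C-odd j′ m))
              (trans (cong (term i′ j′ m +_) (*-zeroʳ (binomialMod2 i′ m * (-1ℤ * θ m))))
                     (+-identityʳ (term i′ j′ m))))
        (pascalEntry-odd-even i′ j′)
    ... | result i′ (suc zero) refl | result j′ (suc zero) refl =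
      -- With both last digits 1, the two halves of each pair differ only in the sign from `θ-odd`,
      -- so they cancel.
      trans (sum-zero {⌈ n /2⌉} {termPair (suc (i′ ℕ.* 2)) (suc (j′ ℕ.* 2)) ∘ toℕ} λ m →
               trans (termPair-≡ (toℕ m) (odd-C-even i′ (toℕ m)) (odd-C-odd i′ (toℕ m))
                                        (odd-C-even j′ (toℕ m)) (odd-C-odd j′ (toℕ m)))
                     (cancel (binomialMod2 i′ (toℕ m)) (θ (toℕ m)) (binomialMod2 j′ (toℕ m))))
            (sym (pascalEntry-odd-odd i′ j′))
      where
      cancel : ∀ x t y → x * t * y + x * (-1ℤ * t) * y ≡ 0ℤ
      cancel = solve-∀

theorem1p1 : (n : ℕ) → n ≥ 1 →
    det (pascalMod2 n) ≡ product {n} (λ k → -1ℤ ^ thueMorse (toℕ k))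
theorem1p1 n _ = trans
  (det-cong (pascalMod2 n) (λ i j → sum {n} (term (toℕ i) (toℕ j) ∘ toℕ))
    λ i j → sym (pascalEntry-LDLᵀ n (toℕ i) (toℕ j) (toℕ<n i)))
  (det-LDLᵀ {n} (λ i l → binomialMod2 (toℕ i) (toℕ l)) (θ ∘ toℕ)
    (λ i → cong (λ c → ℤ.+ (c % 2)) (nCn≡1 (toℕ i)))
    (λ i<j → cong (λ c → ℤ.+ (c % 2)) (k>n⇒nCk≡0 i<j)))
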